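{- Let $n\geq 1$ and let $\mu$ be an update mode written as a finite sequence of blocks (subsets) of elements of $\llbracket n\rrbracket$. Then $\mu\in\mathsf{BS}_n\cap\varphi(\mathsf{BP}_n)$ if and only if $\mu$ is an ordered partition of $\llbracket n\rrbracket$ and all of $\mu$'s blocks are of the same size.
   Context: Notation: $\llbracket n\rrbracket=\{0,\dots,n-1\}$. A sequence $(W_\ell)_{\ell\in\llbracket p\rrbracket}$ of subsets of $\llbracket n\rrbracket$ (blocks) is an ordered partition of $\llbracket n\rrbracket$ if $\bigcup_{\ell\in\llbracket p\rrbracket}W_\ell=\llbracket n\rrbracket$ and $W_i\cap W_j=\emptyset$ for all $i\neq j$. $\mathsf{BS}_n$ is the set of block-sequential update modes of size $n$, i.e. of ordered partitions of $\llbracket n\rrbracket$. A partitioned order of $\llbracket n\rrbracket$ is an (unordered) set $\{S_k\}_{k\in\llbracket s\rrbracket}$ of $s$ sequences $S_k=(i^k_0,\dots,i^k_{n_k-1})$ with $n_k>0$, each consisting of pairwise distinct elements of $\llbracket n\rrbracket$, the sequences being pairwise disjoint (as sets of entries) with union $\llbracket n\rrbracket$. $\mathsf{BP}_n$ is the set of all partitioned orders of $\llbracket n\rrbracket$ (block-parallel update modes of size $n$). For $\mu=\{S_k\}_{k\in\llbracket s\rrbracket}\in\mathsf{BP}_n$, let $p=\mathrm{lcm}(n_0,\dots,n_{s-1})$ and $\varphi(\mu)=(W_\ell)_{\ell\in\llbracket p\rrbracket}$ with $W_\ell=\{i^k_{\ell \bmod n_k}\mid k\in\llbracket s\rrbracket\}$.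 $\varphi(\mathsf{BP}_n)$ is the image of $\mathsf{BP}_n$ under $\varphi$, a set of sequences of blocks. -}

module Defs where

open import Data.Fin.Base using (Fin)
open import Data.Fin.Subset using (Subset; ⊤; ⊥; ⁅_⁆; _∪_; _∩_; ⋃)
open import Data.Fin.Subset.Properties using (∪-assoc; ∪-comm)
open import Data.List.Base using (List; foldr; map; lookup; applyUpTo)
open import Data.List.Membership.Propositional using (_∈_)
open import Data.List.NonEmpty.Base as List⁺ using (List⁺; toList)
open import Data.List.Relation.Binary.Disjoint.Propositional using (Disjoint)
open import Data.List.Relation.Binary.Permutation.Propositional as Perm using (_↭_)
open import Data.List.Relation.Binary.Permutation.Propositional.Properties using (map⁺)
open import Data.List.Relation.Unary.All using (All)
open import Data.List.Relation.Unary.AllPairs using (AllPairs)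
open import Data.List.Relation.Unary.Any using (Any)
open import Data.List.Relation.Unary.Unique.Propositional using (Unique)
open import Data.Nat.Base using (ℕ; zero; suc)
open import Data.Nat.Divisibility using (_∣_; ∣-trans; ∣-antisym)
open import Data.Nat.DivMod using (_mod_)
open import Data.Nat.LCM using (lcm; lcm-least; m∣lcm[m,n]; n∣lcm[m,n])
open import Data.Product.Base using (∃)
open import Level using (0ℓ)
open import Relation.Binary.Core using (Rel)
open import Relation.Binary.PropositionalEquality
  using (_≡_; _≢_; refl; sym; trans; cong; cong₂)
open import Relation.Unary using (Pred)

private
  variable
    A : Set
    n : ℕ

-- A finite sequence (W₀ , … , Wₚ₋₁) of subsets of {0 , … , n - 1}.
BlockSeq : ℕ → Set
BlockSeq n = List (Subset n)

-- Blocks are not required to be nonempty.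
record IsOrderedPartition (W : BlockSeq n) : Set where
  field
    covering : ⋃ W ≡ ⊤
    disjoint : ∀ i j → i ≢ j → lookup W i ∩ lookup W j ≡ ⊥

BS : ∀ n → Pred (BlockSeq n) 0ℓ
BS n = IsOrderedPartition

-- The finite set {S₀ , … , Sₛ₋₁} is represented by a list, considered up to
-- permutation (see _≈_ and φ-cong below).  There are no repetitions in the
-- list, since its entries are nonempty and pairwise disjoint.
record BP (n : ℕ) : Set where
  field
    seqs     : List (List⁺ (Fin n))
    distinct : All (λ S → Unique (toList S)) seqs
    disjoint : AllPairs (λ S T → Disjoint (toList S) (toList T)) seqs
    covering : ∀ x → Any (λ S → x ∈ toList S) seqs

open BP public using (seqs)

_≈_ : Rel (BP n) 0ℓ
μ ≈ ν = seqs μ ↭ seqs ν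

period : List (List⁺ A) → ℕ
period Ss = foldr lcm 1 (map List⁺.length Ss)

at : List⁺ A → ℕ → A
at S ℓ = lookup (toList S) (ℓ mod List⁺.length S)

block : List (List⁺ (Fin n)) → ℕ → Subset n
block Ss ℓ = ⋃ (map (λ S → ⁅ at S ℓ ⁆) Ss)

φ : BP n → BlockSeq n
φ μ = applyUpTo (block (seqs μ)) (period (seqs μ))

φ[BP] : ∀ n → Pred (BlockSeq n) 0ℓ
φ[BP] n W = ∃ λ (μ : BP n) → φ μ ≡ W

private
  foldr-↭ : (_∙_ : A → A → A) (ε : A) →
            (∀ x y z → x ∙ (y ∙ z) ≡ y ∙ (x ∙ z)) →
            ∀ {xs ys} → xs ↭ ys → foldr _∙_ ε xs ≡ foldr _∙_ ε ys
  foldr-↭ _∙_ ε comm Perm.refl         = refl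
  foldr-↭ _∙_ ε comm (Perm.prep x p)   = cong (x ∙_) (foldr-↭ _∙_ ε comm p)
  foldr-↭ _∙_ ε comm (Perm.swap x y p) =
    trans (comm x y _) (cong (λ z → y ∙ (x ∙ z)) (foldr-↭ _∙_ ε comm p))
  foldr-↭ _∙_ ε comm (Perm.trans p q)  =
    trans (foldr-↭ _∙_ ε comm p) (foldr-↭ _∙_ ε comm q)

  lcm-∣ : ∀ x y z → lcm x (lcm y z) ∣ lcm y (lcm x z)
  lcm-∣ x y z = lcm-least
    (∣-trans (m∣lcm[m,n] x z) (n∣lcm[m,n] y (lcm x z)))
    (lcm-least (m∣lcm[m,n] y (lcm x z))
               (∣-trans (n∣lcm[m,n] x z) (n∣lcm[m,n] y (lcm x z))))

  lcm-comm₃ : ∀ x y z → lcm x (lcm y z) ≡ lcm y (lcm x z)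
  lcm-comm₃ x y z = ∣-antisym (lcm-∣ x y z) (lcm-∣ y x z)

  ∪-comm₃ : (p q r : Subset n) → p ∪ (q ∪ r) ≡ q ∪ (p ∪ r)
  ∪-comm₃ p q r =
    trans (sym (∪-assoc p q r)) (trans (cong (_∪ r) (∪-comm p q)) (∪-assoc q p r))

  applyUpTo-cong : {f g : ℕ → A} → (∀ ℓ → f ℓ ≡ g ℓ) →
                   ∀ m → applyUpTo f m ≡ applyUpTo g m
  applyUpTo-cong f≗g zero    = refl
  applyUpTo-cong f≗g (suc m) =
    cong₂ List._∷_ (f≗g 0) (applyUpTo-cong (λ ℓ → f≗g (suc ℓ)) m)

φ-cong : (μ ν : BP n) → μ ≈ ν → φ μ ≡ φ ν
φ-cong μ ν μ≈ν = trans
  (applyUpTo-cong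
    (λ ℓ → foldr-↭ _∪_ ⊥ ∪-comm₃ (map⁺ (λ S → ⁅ at S ℓ ⁆) μ≈ν))
    (period (seqs μ)))
  (cong (applyUpTo (block (seqs ν)))
        (foldr-↭ lcm 1 lcm-comm₃ (map⁺ List⁺.length μ≈ν)))

{-# OPTIONS --safe #-}
module Submission where

-- If φ μ = (W_ℓ), then every block W_ℓ takes exactly one element from each of
-- the pairwise disjoint sequences S_k, so all blocks have as many elements as
-- there are sequences; the periods play no role.  Conversely, if p disjoint
-- blocks all have c elements, take for S_k the sequence of the k-th elements of
-- the successive blocks: these c sequences all have length p, their lcm is p
-- because c is nonzero, and the ℓ-th block of the image collects the elements
-- of W_ℓ.

open import Defs
open import Data.Fin.Base using (Fin; zero; suc; toℕ)
open import Data.Fin.Properties using (toℕ-fromℕ<; toℕ<n; suc-injective; _≟_)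
open import Data.Fin.Subset using (Subset; inside; outside; ⁅_⁆; _∪_; ⋃; ∣_∣)
  renaming (_∈_ to _∈ₛ_; _∉_ to _∉ₛ_)
open import Data.Fin.Subset.Properties
  using (∣⊥∣≡0; ∪-identityˡ; ∉⊥; ∈⊤; x∈⁅x⁆; x∈⁅y⁆⇒x≡y; x∈p∪q⁺; x∈p∪q⁻; x∈p∩q⁺;
         ⊆-antisym)
open import Data.List.Base
  using (List; []; _∷_; length; map; lookup; tabulate; applyUpTo)
open import Data.List.Membership.Propositional using () renaming (_∈_ to _∈ₗ_)
open import Data.List.Membership.Propositional.Properties
  using (∈-lookup; ∈-tabulate⁺; ∈-tabulate⁻)
open import Data.List.NonEmpty.Base as List⁺ using (List⁺; toList; _∷_)
open import Data.List.Properties using (length-tabulate; tabulate-cong; tabulate-lookup)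
open import Data.List.Relation.Binary.Disjoint.Propositional using (Disjoint)
open import Data.List.Relation.Unary.All as All using (All)
import Data.List.Relation.Unary.All.Properties as All
open import Data.List.Relation.Unary.AllPairs using (AllPairs; []; _∷_)
import Data.List.Relation.Unary.AllPairs.Properties as AllPairs
open import Data.List.Relation.Unary.Any as Any using (Any; here; there)
import Data.List.Relation.Unary.Any.Properties as Any
import Data.List.Relation.Unary.Unique.Propositional.Properties as Unique
open import Data.Nat.Base using (ℕ; zero; suc; pred; _<_; _≥_)
open import Data.Nat.Divisibility using (_∣_; ∣-reflexive; ∣-trans; ∣-antisym; 1∣_)
open import Data.Nat.DivMod using (_mod_; m<n⇒m%n≡m)
open import Data.Nat.LCM using (lcm-least; m∣lcm[m,n])
open import Data.Product.Base using (∃; _×_; _,_; proj₁; proj₂)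
open import Data.Sum.Base using (inj₁; inj₂)
open import Data.Vec.Base using ([]; _∷_; here; there)
open import Function.Base using (_∘_)
open import Function.Bundles using (_⇔_; mk⇔)
open import Relation.Binary.PropositionalEquality
  using (_≡_; _≢_; refl; sym; trans; cong; subst; module ≡-Reasoning)
open import Relation.Nullary using (yes; no; contradiction)
open import Relation.Unary using (_∈_; _∩_)

private
  variable
    A : Set
    m n c p : ℕ

∈-⋃⁺ : {x : Fin n} {ps : List (Subset n)} → Any (x ∈ₛ_) ps → x ∈ₛ ⋃ ps
∈-⋃⁺ (here x∈p)   = x∈p∪q⁺ (inj₁ x∈p)
∈-⋃⁺ (there x∈ps) = x∈p∪q⁺ (inj₂ (∈-⋃⁺ x∈ps))

∈-⋃⁻ : {x : Fin n} (ps : List (Subset n)) → x ∈ₛ ⋃ ps → Any (x ∈ₛ_) ps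
∈-⋃⁻ []       x∈⊥ = contradiction x∈⊥ ∉⊥
∈-⋃⁻ (p ∷ ps) x∈∪ with x∈p∪q⁻ p (⋃ ps) x∈∪
... | inj₁ x∈p  = here x∈p
... | inj₂ x∈ps = there (∈-⋃⁻ ps x∈ps)

∣⁅x⁆∪p∣≡1+∣p∣ : {x : Fin n} {p : Subset n} → x ∉ₛ p → ∣ ⁅ x ⁆ ∪ p ∣ ≡ suc ∣ p ∣
∣⁅x⁆∪p∣≡1+∣p∣ {x = zero}  {inside  ∷ p} x∉p = contradiction here x∉p
∣⁅x⁆∪p∣≡1+∣p∣ {x = zero}  {outside ∷ p} x∉p = cong (suc ∘ ∣_∣) (∪-identityˡ p)
∣⁅x⁆∪p∣≡1+∣p∣ {x = suc x} {inside  ∷ p} x∉p = cong suc (∣⁅x⁆∪p∣≡1+∣p∣ (x∉p ∘ there))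
∣⁅x⁆∪p∣≡1+∣p∣ {x = suc x} {outside ∷ p} x∉p = ∣⁅x⁆∪p∣≡1+∣p∣ (x∉p ∘ there)

at∈ : (S : List⁺ A) (ℓ : ℕ) → at S ℓ ∈ₗ toList S
at∈ S ℓ = ∈-lookup {xs = toList S} (ℓ mod List⁺.length S)

∈-block⁻ : {x : Fin n} (Ss : List (List⁺ (Fin n))) (ℓ : ℕ) →
           x ∈ₛ block Ss ℓ → Any (λ S → x ≡ at S ℓ) Ss
∈-block⁻ Ss ℓ x∈ =
  Any.map (λ {S} → x∈⁅y⁆⇒x≡y (at S ℓ)) (Any.map⁻ (∈-⋃⁻ (map (λ S → ⁅ at S ℓ ⁆) Ss) x∈))

∈-block⁺ : {x : Fin n} (Ss : List (List⁺ (Fin n))) (ℓ : ℕ) →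
           Any (λ S → x ≡ at S ℓ) Ss → x ∈ₛ block Ss ℓ
∈-block⁺ Ss ℓ x∈ = ∈-⋃⁺ (Any.map⁺ (Any.map (λ { {S} refl → x∈⁅x⁆ (at S ℓ) }) x∈))

-- Each sequence adds exactly one new element: if `at S ℓ` lay in the block of the remaining
-- sequences, it would be an entry of one of them as well as of `S`.
∣block∣≡length : {Ss : List (List⁺ (Fin n))} →
                 AllPairs (λ S T → Disjoint (toList S) (toList T)) Ss →
                 ∀ ℓ → ∣ block Ss ℓ ∣ ≡ length Ss
∣block∣≡length {n} {[]}     []           ℓ = ∣⊥∣≡0 n
∣block∣≡length {n} {S ∷ Ss} (S#Ss ∷ Ss#) ℓ =
  trans (∣⁅x⁆∪p∣≡1+∣p∣ at∉block) (cong suc (∣block∣≡length Ss# ℓ))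
  where
  at∉block : at S ℓ ∉ₛ block Ss ℓ
  at∉block at∈block =
    let at∈Ss     = ∈-block⁻ Ss ℓ at∈block
        T         = Any.lookup at∈Ss
        S#T , S≡T = All.lookupAny S#Ss at∈Ss
    in S#T (at∈ S ℓ , subst (_∈ₗ toList T) (sym S≡T) (at∈ T ℓ))

φ-equal-sizes : (ν : BP n) → ∀ i j → ∣ lookup (φ ν) i ∣ ≡ ∣ lookup (φ ν) j ∣
φ-equal-sizes ν i j = trans (size i) (sym (size j))
  where
  size : ∀ i → ∣ lookup (φ ν) i ∣ ≡ length (seqs ν)
  size i = All.lookup {P = λ p → ∣ p ∣ ≡ length (seqs ν)}
    (All.applyUpTo⁺₂ (block (seqs ν)) (period (seqs ν)) (∣block∣≡length (BP.disjoint ν)))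
    (∈-lookup {xs = φ ν} i)

-- `c` is a parameter instead of `∣ p ∣`, so that different blocks of equal size can be indexed by
-- the same `Fin c`.
record Enumeration (p : Subset n) (c : ℕ) : Set where
  field
    nth           : Fin c → Fin n
    nth-injective : ∀ {k l} → nth k ≡ nth l → k ≡ l
    nth-∈         : ∀ k → nth k ∈ₛ p
    index         : ∀ {x} → x ∈ₛ p → ∃ λ k → x ≡ nth k

open Enumeration

enumerate : (p : Subset n) → Enumeration p ∣ p ∣
enumerate [] = record
  { nth = λ () ; nth-injective = λ { {()} } ; nth-∈ = λ () ; index = λ () }
enumerate (outside ∷ p) = record
  { nth           = suc ∘ nth E
  ; nth-injective = nth-injective E ∘ suc-injective
  ; nth-∈         = λ k → there (nth-∈ E k)
  ; index         = λ { (there x∈p) → let k , eq = index E x∈p in k , cong suc eq }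
  }
  where E = enumerate p
enumerate (inside ∷ p) = record
  { nth           = λ { zero → zero ; (suc k) → suc (nth E k) }
  ; nth-injective = λ
    { {zero}  {zero}  eq → refl
    ; {suc k} {suc l} eq → cong suc (nth-injective E (suc-injective eq))
    }
  ; nth-∈         = λ { zero → here ; (suc k) → there (nth-∈ E k) }
  ; index         = λ
    { here        → zero , refl
    ; (there x∈p) → let k , eq = index E x∈p in suc k , cong suc eq
    }
  }
  where E = enumerate p

-- The two indices have different types; comparing their values under `toℕ` avoids a cast along
-- `length-tabulate`.
lookup-tabulate-toℕ : (f : Fin m → A) {j : Fin (length (tabulate f))} {i : Fin m} →
                      toℕ j ≡ toℕ i → lookup (tabulate f) j ≡ f i
lookup-tabulate-toℕ f {zero}  {zero}  eq = refl
lookup-tabulate-toℕ f {suc j} {suc i} eq = lookup-tabulate-toℕ (f ∘ suc) (cong pred eq)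

applyUpTo≡tabulate : (f : ℕ → A) (m : ℕ) → applyUpTo f m ≡ tabulate {n = m} (f ∘ toℕ)
applyUpTo≡tabulate f zero    = refl
applyUpTo≡tabulate f (suc m) = cong (f 0 ∷_) (applyUpTo≡tabulate (f ∘ suc) m)

period-∣ : {Ss : List (List⁺ A)} → All (λ S → List⁺.length S ∣ p) Ss → period Ss ∣ p
period-∣ All.[]          = 1∣ _
period-∣ (S∣p All.∷ Ss∣p) = lcm-least S∣p (period-∣ Ss∣p)

-- The argument of type `Fin c` ensures that there is a first sequence, whose length `p` divides the
-- period. With no sequences the period would be 1 whatever `p` is.
period-tabulate : (f : Fin c → List⁺ A) → (∀ k → List⁺.length (f k) ≡ p) →
                  Fin c → period (tabulate f) ≡ p
period-tabulate {c = suc c} f len _ = ∣-antisym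
  (period-∣ (All.tabulate⁺ {f = f} (∣-reflexive ∘ len)))
  (∣-trans (∣-reflexive (sym (len zero))) (m∣lcm[m,n] (List⁺.length (f zero)) (period (tabulate (f ∘ suc)))))

-- `toList (tabulate⁺ f)` reduces to `tabulate f`, so facts about `tabulate` apply directly.
tabulate⁺ : (Fin (suc m) → A) → List⁺ A
tabulate⁺ f = f zero ∷ tabulate (f ∘ suc)

length-tabulate⁺ : (f : Fin (suc m) → A) → List⁺.length (tabulate⁺ f) ≡ suc m
length-tabulate⁺ = length-tabulate

at-tabulate⁺ : (f : Fin (suc m) → A) (i : Fin (suc m)) → at (tabulate⁺ f) (toℕ i) ≡ f i
-- `toℕ i` is below the length, so the reduction modulo the length in `at` leaves it unchanged.
at-tabulate⁺ f i = lookup-tabulate-toℕ f (trans (toℕ-fromℕ< _)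
  (m<n⇒m%n≡m (subst (λ l → toℕ i < l) (sym (length-tabulate⁺ f)) (toℕ<n i))))

module _ {n : ℕ} {W : BlockSeq n} (W-partition : IsOrderedPartition W) where
  open IsOrderedPartition W-partition

  block-of : ∀ x → ∃ λ i → x ∈ₛ lookup W i
  block-of x = Any.index x∈W , Any.lookup-index x∈W
    where x∈W = ∈-⋃⁻ W (subst (x ∈ₛ_) (sym covering) ∈⊤)

  block-unique : ∀ {x i j} → x ∈ₛ lookup W i → x ∈ₛ lookup W j → i ≡ j
  block-unique {x} {i} {j} x∈Wᵢ x∈Wⱼ with i ≟ j
  ... | yes i≡j = i≡j
  ... | no  i≢j = contradiction (subst (x ∈ₛ_) (disjoint i j i≢j) (x∈p∩q⁺ (x∈Wᵢ , x∈Wⱼ))) ∉⊥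

-- The entries `nth (E i) k` form a matrix whose row `i` lists block `i`. Having a first block `W₀`
-- makes every column a nonempty sequence.
module Transpose {W₀ : Subset n} {Ws : BlockSeq n}
                 (W-partition : IsOrderedPartition (W₀ ∷ Ws))
                 (E : ∀ i → Enumeration (lookup (W₀ ∷ Ws) i) c)
                 where

  W : BlockSeq n
  W = W₀ ∷ Ws

  column : Fin c → List⁺ (Fin n)
  column k = tabulate⁺ (λ i → nth (E i) k)

  at-column : ∀ k i → at (column k) (toℕ i) ≡ nth (E i) k
  at-column k = at-tabulate⁺ (λ i → nth (E i) k)

  columns : List (List⁺ (Fin n))
  columns = tabulate column

  -- A shared entry would lie in both blocks. With `k = l` this shows that a column has no
  -- repetitions; together with `columns-equal` it says that all matrix entries are distinct.
  rows-equal : ∀ {i j k l} → nth (E i) k ≡ nth (E j) l → i ≡ j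
  rows-equal {i} {j} {k} {l} eq = block-unique W-partition
    (nth-∈ (E i) k) (subst (_∈ₛ lookup W j) (sym eq) (nth-∈ (E j) l))

  columns-equal : ∀ {i j k l} → nth (E i) k ≡ nth (E j) l → k ≡ l
  columns-equal {i} eq with refl ← rows-equal eq = nth-injective (E i) eq

  columns-disjoint : ∀ {k l} → k ≢ l → Disjoint (toList (column k)) (toList (column l))
  columns-disjoint {k} {l} k≢l (x∈k , x∈l) =
    let i , x≡eᵢₖ = ∈-tabulate⁻ {f = λ i → nth (E i) k} x∈k
        j , x≡eⱼₗ = ∈-tabulate⁻ {f = λ j → nth (E j) l} x∈l
    in k≢l (columns-equal {i} {j} (trans (sym x≡eᵢₖ) x≡eⱼₗ))

  partitionedOrder : BP n
  partitionedOrder = record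
    { seqs     = columns
    ; distinct = All.tabulate⁺ (λ k → Unique.tabulate⁺ (rows-equal {k = k} {l = k}))
    ; disjoint = AllPairs.tabulate⁺ columns-disjoint
    ; covering = λ x →
        let i , x∈Wᵢ  = block-of W-partition x
            k , x≡eᵢₖ = index (E i) x∈Wᵢ
        in Any.tabulate⁺ k
             (subst (_∈ₗ toList (column k)) (sym x≡eᵢₖ) (∈-tabulate⁺ {f = λ i → nth (E i) k} i))
    }

  -- The `i`-th entries of the columns are the `nth (E i) k` for all `k`, which exhaust block `i`.
  block-columns : ∀ i → block columns (toℕ i) ≡ lookup W i
  block-columns i = ⊆-antisym ⊆W ⊇W
    where
    ⊆W : ∀ {x} → x ∈ₛ block columns (toℕ i) → x ∈ₛ lookup W i
    ⊆W x∈ with k , refl ← Any.tabulate⁻ (∈-block⁻ columns (toℕ i) x∈) =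
      subst (_∈ₛ lookup W i) (sym (at-column k i)) (nth-∈ (E i) k)

    ⊇W : ∀ {x} → x ∈ₛ lookup W i → x ∈ₛ block columns (toℕ i)
    ⊇W x∈Wᵢ = let k , x≡eᵢₖ = index (E i) x∈Wᵢ in
      ∈-block⁺ columns (toℕ i) (Any.tabulate⁺ k (trans x≡eᵢₖ (sym (at-column k i))))

  φ-partitionedOrder : Fin c → φ partitionedOrder ≡ W
  φ-partitionedOrder k = begin
    applyUpTo (block columns) (period columns)
      ≡⟨ cong (applyUpTo (block columns))
              (period-tabulate column (λ k → length-tabulate⁺ (λ i → nth (E i) k)) k) ⟩
    applyUpTo (block columns) (length W)
      -- Indexing by `Fin (length W)` leaves only the positions covered by `block-columns`.
      ≡⟨ applyUpTo≡tabulate (block columns) (length W) ⟩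
    tabulate {n = length W} (block columns ∘ toℕ)
      ≡⟨ tabulate-cong block-columns ⟩
    tabulate (lookup W)
      ≡⟨ tabulate-lookup W ⟩
    W ∎
    where open ≡-Reasoning

equal-sizes⇒φ[BP] : Fin n → {W : BlockSeq n} → IsOrderedPartition W →
                    (∀ i j → ∣ lookup W i ∣ ≡ ∣ lookup W j ∣) → W ∈ φ[BP] n
-- An empty sequence of blocks cannot cover `x`.
equal-sizes⇒φ[BP] x {[]} W-partition sizes with () ← proj₁ (block-of W-partition x)
equal-sizes⇒φ[BP] x {W₀ ∷ Ws} W-partition sizes =
  -- The position of `x` in its block shows that the common size is nonzero.
  partitionedOrder , φ-partitionedOrder (proj₁ (index (E i) x∈Wᵢ))
  where
  W : BlockSeq _
  W = W₀ ∷ Ws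

  E : ∀ i → Enumeration (lookup W i) ∣ W₀ ∣
  -- Equality of sizes enters here: every enumeration is transported to the size of the first block.
  E i = subst (Enumeration _) (sizes i zero) (enumerate (lookup W i))

  i    = proj₁ (block-of W-partition x)
  x∈Wᵢ = proj₂ (block-of W-partition x)

  open Transpose W-partition E

lemma1 : (n : ℕ) → n ≥ 1 → (μ : BlockSeq n) →
    (μ ∈ BS n ∩ φ[BP] n) ⇔
    (IsOrderedPartition μ × (∀ i j → ∣ lookup μ i ∣ ≡ ∣ lookup μ j ∣))
-- Since `n` is a successor, `zero` is an element of the ground set, as the converse direction
-- requires.
lemma1 (suc n) n≥1 μ = mk⇔
  (λ { (μ∈BS , ν , refl) → μ∈BS , φ-equal-sizes ν })
  (λ { (μ∈BS , sizes) → μ∈BS , equal-sizes⇒φ[BP] zero μ∈BS sizes })
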